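{- Let $T_1=(V_1,E_1)$ and $T_2=(V_2,E_2)$ be trees with $|V_1|=|V_2|=n$. Suppose there exist labelings $\mathcal{L}_1,\mathcal{L}_2$ and edge orderings $\pi_1,\pi_2$ of $T_1,T_2$ respectively, and an element $\sigma\in S_n$, such that $$\sigma\,\mathcal{K}_{\mathcal{L}_1,\pi_1}(T_1)\,\sigma^{ -1}=\mathcal{K}_{\mathcal{L}_2,\pi_2}(T_2).$$ Then $T_1$ and $T_2$ are isomorphic.
   Context: $\mathbb{C}[S_n]$ is the group algebra of the symmetric group $S_n$. A labeling of a graph $G=(V,E)$ with $|V|=n$ is a bijection $\mathcal{L}:V\to\{1,\dots,n\}$; under it an edge $\{u,v\}$ corresponds to the transposition $(\mathcal{L}(u)\,\mathcal{L}(v))\in S_n$. For a labeling $\mathcal{L}$ and an ordering $\pi=(e_1,\dots,e_m)$ of $E$, $\mathcal{K}_{\mathcal{L},\pi}(G)=n!\,(1-t_1)(1-t_2)\cdots(1-t_m)\in\mathbb{C}[S_n]$, where $t_r$ is the transposition corresponding to $e_r$ under $\mathcal{L}$ and the product is in the order of $\pi$. -}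

module Defs where

open import Algebra.Bundles using (Group; CommutativeRing)
open import Data.Bool.Base using (if_then_else_)
open import Data.Fin.Base using (Fin)
open import Data.Fin.Permutation as Perm using (Permutation′; transpose; _∘ₚ_; _⟨$⟩ʳ_)
import Data.Fin.Properties as Fin
open import Data.List.Base
  using (List; []; _∷_; _++_; _∷ʳ_; foldr; map; length; cartesianProductWith)
import Data.List.Membership.Setoid as Membership
open import Data.List.Relation.Unary.Linked using (Linked)
import Data.List.Relation.Unary.Unique.Propositional as UniqueP
import Data.List.Relation.Unary.Unique.Setoid as UniqueS
open import Data.Nat.Base as ℕ using (ℕ; _!)
import Data.Nat.Properties as ℕ
open import Data.Product.Base using (Σ-syntax; ∃-syntax; _×_; _,_)
open import Data.Rational.Base as ℚ using (ℚ; 0ℚ; 1ℚ; ½; ∣_∣; 1/_)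
import Data.Rational.Properties as ℚ
open import Data.Rational.Solver using (module +-*-Solver)
open import Data.Sum.Base using (_⊎_; inj₁; inj₂)
open import Function.Bundles using (_⤖_; _⇔_; Bijection)
open import Level using (Level; 0ℓ)
open import Relation.Binary.Bundles using (Setoid)
open import Relation.Binary.Construct.Closure.ReflexiveTransitive using (Star)
open import Relation.Binary.Definitions
  using (Decidable; Symmetric; Irreflexive; Reflexive; Transitive)
open import Relation.Binary.PropositionalEquality
  using (_≡_; refl; sym; trans; cong; subst)
open import Relation.Nullary using (¬_; does)

-- The real numbers: Cauchy sequences of rationals, two of which are
-- equal when their difference tends to 0.

module Reals where

  private
    ½+½ : ∀ ε → ε ℚ.* ½ ℚ.+ ε ℚ.* ½ ≡ ε
    ½+½ ε = trans (sym (ℚ.*-distribˡ-+ ε ½ ½)) (ℚ.*-identityʳ ε)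

    half>0 : ∀ {ε} → 0ℚ ℚ.< ε → 0ℚ ℚ.< ε ℚ.* ½
    half>0 {ε} ε>0 =
      ℚ.positive⁻¹ _ {{ℚ.pos*pos⇒pos ε {{ℚ.positive ε>0}} ½}}

    ∣+∣< : ∀ {ε} p q → ∣ p ∣ ℚ.< ε ℚ.* ½ → ∣ q ∣ ℚ.< ε ℚ.* ½ → ∣ p ℚ.+ q ∣ ℚ.< ε
    ∣+∣< {ε} p q p< q< = ℚ.≤-<-trans (ℚ.∣p+q∣≤∣p∣+∣q∣ p q)
      (subst (∣ p ∣ ℚ.+ ∣ q ∣ ℚ.<_) (½+½ ε) (ℚ.+-mono-< p< q<))

    quotient : ∀ B → 0ℚ ℚ.< B → ℚ → ℚ
    quotient B B>0 ε = 1/_ B {{ℚ.pos⇒nonZero B {{ℚ.positive B>0}}}} ℚ.* ε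

    quotient>0 : ∀ B (B>0 : 0ℚ ℚ.< B) {ε} → 0ℚ ℚ.< ε → 0ℚ ℚ.< quotient B B>0 ε
    quotient>0 B B>0 {ε} ε>0 =
      ℚ.positive⁻¹ _ {{ℚ.pos*pos⇒pos (1/_ B {{ℚ.pos⇒nonZero B {{ℚ.positive B>0}}}})
                                     {{ℚ.1/pos⇒pos B {{ℚ.positive B>0}}}}
                                     ε {{ℚ.positive ε>0}}}}

    ∣*∣< : ∀ B (B>0 : 0ℚ ℚ.< B) {ε} p q →
           ∣ p ∣ ℚ.< B → ∣ q ∣ ℚ.< quotient B B>0 ε → ∣ p ℚ.* q ∣ ℚ.< ε
    ∣*∣< B B>0 {ε} p q p<B q< =
      subst (ℚ._< ε) (sym (ℚ.∣p*q∣≡∣p∣*∣q∣ p q))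
        (ℚ.≤-<-trans
          (ℚ.*-monoʳ-≤-nonNeg ∣ q ∣ {{ℚ.∣-∣-nonNeg q}} (ℚ.<⇒≤ p<B))
          (subst (B ℚ.* ∣ q ∣ ℚ.<_) B*quotient
            (ℚ.*-monoʳ-<-pos B {{ℚ.positive B>0}} q<)))
      where
      instance
        B≢0 : ℚ.NonZero B
        B≢0 = ℚ.pos⇒nonZero B {{ℚ.positive B>0}}
      B*quotient : B ℚ.* (1/ B ℚ.* ε) ≡ ε
      B*quotient = trans (sym (ℚ.*-assoc B (1/ B) ε))
        (trans (cong (ℚ._* ε) (ℚ.*-inverseʳ B)) (ℚ.*-identityˡ ε))

    ∣-∣-comm : ∀ p q → ∣ p ℚ.- q ∣ ≡ ∣ q ℚ.- p ∣
    ∣-∣-comm p q = trans (sym (ℚ.∣-p∣≡∣p∣ (p ℚ.- q)))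
      (cong ∣_∣ (solve 2 (λ p q → :- (p :- q) := q :- p) refl p q))
      where open +-*-Solver

    triangle : ∀ {ε} p q r → ∣ p ℚ.- q ∣ ℚ.< ε ℚ.* ½ → ∣ q ℚ.- r ∣ ℚ.< ε ℚ.* ½ →
               ∣ p ℚ.- r ∣ ℚ.< ε
    triangle {ε} p q r pq qr = subst (λ s → ∣ s ∣ ℚ.< ε)
      (solve 3 (λ p q r → (p :- q) :+ (q :- r) := p :- r) refl p q r)
      (∣+∣< (p ℚ.- q) (q ℚ.- r) pq qr)
      where open +-*-Solver

    difference-+ : ∀ {ε} p q r s → ∣ p ℚ.- r ∣ ℚ.< ε ℚ.* ½ → ∣ q ℚ.- s ∣ ℚ.< ε ℚ.* ½ →
                   ∣ (p ℚ.+ q) ℚ.- (r ℚ.+ s) ∣ ℚ.< ε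
    difference-+ {ε} p q r s pr qs = subst (λ t → ∣ t ∣ ℚ.< ε)
      (solve 4 (λ p q r s → (p :- r) :+ (q :- s) := (p :+ q) :- (r :+ s)) refl p q r s)
      (∣+∣< (p ℚ.- r) (q ℚ.- s) pr qs)
      where open +-*-Solver

    difference-neg : ∀ {ε} p q → ∣ p ℚ.- q ∣ ℚ.< ε → ∣ ℚ.- p ℚ.- ℚ.- q ∣ ℚ.< ε
    difference-neg {ε} p q = subst (ℚ._< ε)
      (trans (∣-∣-comm p q)
        (cong ∣_∣ (solve 2 (λ p q → q :- p := (:- p) :- (:- q)) refl p q)))
      where open +-*-Solver

    difference-* : ∀ B (B>0 : 0ℚ ℚ.< B) C (C>0 : 0ℚ ℚ.< C) {ε} p q r s →
                   ∣ p ∣ ℚ.< B → ∣ s ∣ ℚ.< C →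
                   ∣ p ℚ.- r ∣ ℚ.< quotient C C>0 (ε ℚ.* ½) →
                   ∣ q ℚ.- s ∣ ℚ.< quotient B B>0 (ε ℚ.* ½) →
                   ∣ (p ℚ.* q) ℚ.- (r ℚ.* s) ∣ ℚ.< ε
    difference-* B B>0 C C>0 {ε} p q r s p<B s<C pr qs = subst (λ t → ∣ t ∣ ℚ.< ε)
      (solve 4 (λ p q r s → p :* (q :- s) :+ s :* (p :- r) := (p :* q) :- (r :* s))
        refl p q r s)
      (∣+∣< (p ℚ.* (q ℚ.- s)) (s ℚ.* (p ℚ.- r))
        (∣*∣< B B>0 p (q ℚ.- s) p<B qs) (∣*∣< C C>0 s (p ℚ.- r) s<C pr))
      where open +-*-Solver

  IsCauchy : (ℕ → ℚ) → Set
  IsCauchy x = ∀ ε → 0ℚ ℚ.< ε →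
    ∃[ N ] (∀ m n → N ℕ.≤ m → N ℕ.≤ n → ∣ x m ℚ.- x n ∣ ℚ.< ε)

  record ℝ : Set where
    no-eta-equality
    constructor mkℝ
    field
      seq      : ℕ → ℚ
      isCauchy : IsCauchy seq
  open ℝ public

  infix 4 _≈_
  record _≈_ (x y : ℝ) : Set where
    constructor mk≈
    field
      limit : ∀ ε → 0ℚ ℚ.< ε →
        ∃[ N ] (∀ n → N ℕ.≤ n → ∣ seq x n ℚ.- seq y n ∣ ℚ.< ε)
  open _≈_ public

  pointwise⇒≈ : ∀ x y → (∀ n → seq x n ≡ seq y n) → x ≈ y
  pointwise⇒≈ x y x≗y .limit ε ε>0 = 0 , λ n _ →
    subst (λ p → ∣ p ∣ ℚ.< ε)
      (sym (trans (cong (ℚ._- seq y n) (x≗y n)) (ℚ.+-inverseʳ (seq y n)))) ε>0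

  ≈-refl : Reflexive _≈_
  ≈-refl {x} = pointwise⇒≈ x x (λ _ → refl)

  ≈-sym : Symmetric _≈_
  ≈-sym {x} {y} x≈y .limit ε ε>0 = let N , close = limit x≈y ε ε>0 in
    N , λ n N≤n → subst (ℚ._< ε) (∣-∣-comm (seq x n) (seq y n)) (close n N≤n)

  ≈-trans : Transitive _≈_
  ≈-trans {x} {y} {z} x≈y y≈z .limit ε ε>0 =
    let M , xy = limit x≈y _ (half>0 ε>0)
        N , yz = limit y≈z _ (half>0 ε>0)
    in M ℕ.⊔ N , λ n ≤n → triangle (seq x n) (seq y n) (seq z n)
         (xy n (ℕ.m⊔n≤o⇒m≤o M N ≤n)) (yz n (ℕ.m⊔n≤o⇒n≤o M N ≤n))

  private
    bound : ∀ x → ∃[ B ] 0ℚ ℚ.< B × ∃[ N ] (∀ n → N ℕ.≤ n → ∣ seq x n ∣ ℚ.< B)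
    bound x =
      let N , close = isCauchy x 1ℚ (ℚ.positive⁻¹ 1ℚ)
          a = seq x N
      in 1ℚ ℚ.+ ∣ a ∣
       , ℚ.+-mono-<-≤ (ℚ.positive⁻¹ 1ℚ) (ℚ.0≤∣p∣ a)
       , N , λ n N≤n → subst (λ p → ∣ p ∣ ℚ.< 1ℚ ℚ.+ ∣ a ∣)
           (solve 2 (λ p q → (p :- q) :+ q := p) refl (seq x n) a)
           (ℚ.≤-<-trans (ℚ.∣p+q∣≤∣p∣+∣q∣ (seq x n ℚ.- a) a)
             (ℚ.+-monoˡ-< ∣ a ∣ (close n N N≤n ℕ.≤-refl)))
      where open +-*-Solver

  const : ℚ → ℝ
  const q .seq _ = q
  const q .isCauchy ε ε>0 = 0 , λ _ _ _ _ →
    subst (λ p → ∣ p ∣ ℚ.< ε) (sym (ℚ.+-inverseʳ q)) ε>0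

  infixl 6 _+_
  _+_ : ℝ → ℝ → ℝ
  (x + y) .seq n = seq x n ℚ.+ seq y n
  (x + y) .isCauchy ε ε>0 =
    let M , cx = isCauchy x _ (half>0 ε>0)
        N , cy = isCauchy y _ (half>0 ε>0)
    in M ℕ.⊔ N , λ m n ≤m ≤n →
         difference-+ (seq x m) (seq y m) (seq x n) (seq y n)
           (cx m n (ℕ.m⊔n≤o⇒m≤o M N ≤m) (ℕ.m⊔n≤o⇒m≤o M N ≤n))
           (cy m n (ℕ.m⊔n≤o⇒n≤o M N ≤m) (ℕ.m⊔n≤o⇒n≤o M N ≤n))

  infix 8 -_
  -_ : ℝ → ℝ
  (- x) .seq n = ℚ.- seq x n
  (- x) .isCauchy ε ε>0 = let N , cx = isCauchy x ε ε>0 in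
    N , λ m n ≤m ≤n → difference-neg (seq x m) (seq x n) (cx m n ≤m ≤n)

  infixl 7 _*_
  _*_ : ℝ → ℝ → ℝ
  (x * y) .seq n = seq x n ℚ.* seq y n
  (x * y) .isCauchy ε ε>0 =
    let B , B>0 , K , x<B = bound x
        C , C>0 , L , y<C = bound y
        M , cx = isCauchy x _ (quotient>0 C C>0 (half>0 ε>0))
        N , cy = isCauchy y _ (quotient>0 B B>0 (half>0 ε>0))
        P = (K ℕ.⊔ L) ℕ.⊔ (M ℕ.⊔ N)
        KL : ∀ {n} → P ℕ.≤ n → K ℕ.⊔ L ℕ.≤ n
        KL = ℕ.m⊔n≤o⇒m≤o (K ℕ.⊔ L) (M ℕ.⊔ N)
        MN : ∀ {n} → P ℕ.≤ n → M ℕ.⊔ N ℕ.≤ n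
        MN = ℕ.m⊔n≤o⇒n≤o (K ℕ.⊔ L) (M ℕ.⊔ N)
    in P , λ m n ≤m ≤n →
         difference-* B B>0 C C>0 (seq x m) (seq y m) (seq x n) (seq y n)
           (x<B m (ℕ.m⊔n≤o⇒m≤o K L (KL ≤m)))
           (y<C n (ℕ.m⊔n≤o⇒n≤o K L (KL ≤n)))
           (cx m n (ℕ.m⊔n≤o⇒m≤o M N (MN ≤m)) (ℕ.m⊔n≤o⇒m≤o M N (MN ≤n)))
           (cy m n (ℕ.m⊔n≤o⇒n≤o M N (MN ≤m)) (ℕ.m⊔n≤o⇒n≤o M N (MN ≤n)))

  private
    +-cong : ∀ {x x′ y y′} → x ≈ x′ → y ≈ y′ → x + y ≈ x′ + y′
    +-cong {x} {x′} {y} {y′} x≈ y≈ .limit ε ε>0 =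
      let M , xx = limit x≈ _ (half>0 ε>0)
          N , yy = limit y≈ _ (half>0 ε>0)
      in M ℕ.⊔ N , λ n ≤n →
           difference-+ (seq x n) (seq y n) (seq x′ n) (seq y′ n)
             (xx n (ℕ.m⊔n≤o⇒m≤o M N ≤n)) (yy n (ℕ.m⊔n≤o⇒n≤o M N ≤n))

    -‿cong : ∀ {x x′} → x ≈ x′ → - x ≈ - x′
    -‿cong {x} {x′} x≈ .limit ε ε>0 = let N , xx = limit x≈ ε ε>0 in
      N , λ n ≤n → difference-neg (seq x n) (seq x′ n) (xx n ≤n)

    *-cong : ∀ {x x′ y y′} → x ≈ x′ → y ≈ y′ → x * y ≈ x′ * y′
    *-cong {x} {x′} {y} {y′} x≈ y≈ .limit ε ε>0 =
      let B , B>0 , K , x<B = bound x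
          C , C>0 , L , y<C = bound y′
          M , xx = limit x≈ _ (quotient>0 C C>0 (half>0 ε>0))
          N , yy = limit y≈ _ (quotient>0 B B>0 (half>0 ε>0))
          KL : ∀ {n} → (K ℕ.⊔ L) ℕ.⊔ (M ℕ.⊔ N) ℕ.≤ n → K ℕ.⊔ L ℕ.≤ n
          KL = ℕ.m⊔n≤o⇒m≤o (K ℕ.⊔ L) (M ℕ.⊔ N)
          MN : ∀ {n} → (K ℕ.⊔ L) ℕ.⊔ (M ℕ.⊔ N) ℕ.≤ n → M ℕ.⊔ N ℕ.≤ n
          MN = ℕ.m⊔n≤o⇒n≤o (K ℕ.⊔ L) (M ℕ.⊔ N)
      in (K ℕ.⊔ L) ℕ.⊔ (M ℕ.⊔ N) , λ n ≤n →
           difference-* B B>0 C C>0 (seq x n) (seq y n) (seq x′ n) (seq y′ n)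
             (x<B n (ℕ.m⊔n≤o⇒m≤o K L (KL ≤n)))
             (y<C n (ℕ.m⊔n≤o⇒n≤o K L (KL ≤n)))
             (xx n (ℕ.m⊔n≤o⇒m≤o M N (MN ≤n)))
             (yy n (ℕ.m⊔n≤o⇒n≤o M N (MN ≤n)))

  ℝ-commutativeRing : CommutativeRing 0ℓ 0ℓ
  ℝ-commutativeRing = record
    { Carrier = ℝ ; _≈_ = _≈_ ; _+_ = _+_ ; _*_ = _*_ ; -_ = -_
    ; 0# = const 0ℚ ; 1# = const 1ℚ
    ; isCommutativeRing = record
      { isRing = record
        { +-isAbelianGroup = record
          { isGroup = record
            { isMonoid = record
              { isSemigroup = record
                { isMagma = record
                  { isEquivalence = record
                      { refl = ≈-refl ; sym = ≈-sym ; trans = ≈-trans }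
                  ; ∙-cong = +-cong }
                ; assoc = λ x y z → pointwise⇒≈ _ _ λ n →
                    ℚ.+-assoc (seq x n) (seq y n) (seq z n) }
              ; identity = (λ x → pointwise⇒≈ _ _ λ n → ℚ.+-identityˡ (seq x n))
                         , (λ x → pointwise⇒≈ _ _ λ n → ℚ.+-identityʳ (seq x n)) }
            ; inverse = (λ x → pointwise⇒≈ _ _ λ n → ℚ.+-inverseˡ (seq x n))
                      , (λ x → pointwise⇒≈ _ _ λ n → ℚ.+-inverseʳ (seq x n))
            ; ⁻¹-cong = -‿cong }
          ; comm = λ x y → pointwise⇒≈ _ _ λ n → ℚ.+-comm (seq x n) (seq y n) }
        ; *-cong = *-cong
        ; *-assoc = λ x y z → pointwise⇒≈ _ _ λ n →
            ℚ.*-assoc (seq x n) (seq y n) (seq z n)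
        ; *-identity = (λ x → pointwise⇒≈ _ _ λ n → ℚ.*-identityˡ (seq x n))
                     , (λ x → pointwise⇒≈ _ _ λ n → ℚ.*-identityʳ (seq x n))
        ; distrib = (λ x y z → pointwise⇒≈ _ _ λ n →
                       ℚ.*-distribˡ-+ (seq x n) (seq y n) (seq z n))
                  , (λ x y z → pointwise⇒≈ _ _ λ n →
                       ℚ.*-distribʳ-+ (seq x n) (seq y n) (seq z n)) }
      ; *-comm = λ x y → pointwise⇒≈ _ _ λ n → ℚ.*-comm (seq x n) (seq y n) } }

-- The complex numbers, as pairs re + i·im

module Complex where

  open Reals using (ℝ; seq; pointwise⇒≈; ℝ-commutativeRing)

  private
    module R = CommutativeRing ℝ-commutativeRing

  record ℂ : Set where
    constructor _+i_
    field
      re im : ℝ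
  open ℂ public

  infix 4 _≈_
  record _≈_ (z w : ℂ) : Set where
    constructor mk≈
    field
      re≈ : re z R.≈ re w
      im≈ : im z R.≈ im w
  open _≈_ public

  infixl 6 _+_
  _+_ : ℂ → ℂ → ℂ
  z + w = (re z R.+ re w) +i (im z R.+ im w)

  infixl 7 _*_
  _*_ : ℂ → ℂ → ℂ
  z * w = (re z R.* re w R.+ R.- (im z R.* im w))
       +i (re z R.* im w R.+ im z R.* re w)

  infix 8 -_
  -_ : ℂ → ℂ
  - z = (R.- re z) +i (R.- im z)

  0ℂ 1ℂ : ℂ
  0ℂ = R.0# +i R.0#
  1ℂ = R.1# +i R.0#

  private
    re-assoc : ∀ p q r s t u →
      (p R.* r R.+ R.- (q R.* s)) R.* t R.+ R.- ((p R.* s R.+ q R.* r) R.* u) R.≈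
      p R.* (r R.* t R.+ R.- (s R.* u)) R.+ R.- (q R.* (r R.* u R.+ s R.* t))
    re-assoc p q r s t u = pointwise⇒≈ _ _ λ n → solve 6
      (λ p q r s t u →
        (p :* r :+ :- (q :* s)) :* t :+ :- ((p :* s :+ q :* r) :* u) :=
        p :* (r :* t :+ :- (s :* u)) :+ :- (q :* (r :* u :+ s :* t))) refl
      (seq p n) (seq q n) (seq r n) (seq s n) (seq t n) (seq u n)
      where open +-*-Solver

    im-assoc : ∀ p q r s t u →
      (p R.* r R.+ R.- (q R.* s)) R.* u R.+ (p R.* s R.+ q R.* r) R.* t R.≈
      p R.* (r R.* u R.+ s R.* t) R.+ q R.* (r R.* t R.+ R.- (s R.* u))
    im-assoc p q r s t u = pointwise⇒≈ _ _ λ n → solve 6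
      (λ p q r s t u →
        (p :* r :+ :- (q :* s)) :* u :+ (p :* s :+ q :* r) :* t :=
        p :* (r :* u :+ s :* t) :+ q :* (r :* t :+ :- (s :* u))) refl
      (seq p n) (seq q n) (seq r n) (seq s n) (seq t n) (seq u n)
      where open +-*-Solver

    re-distrib : ∀ p q r s t u →
      p R.* (r R.+ t) R.+ R.- (q R.* (s R.+ u)) R.≈
      (p R.* r R.+ R.- (q R.* s)) R.+ (p R.* t R.+ R.- (q R.* u))
    re-distrib p q r s t u = pointwise⇒≈ _ _ λ n → solve 6
      (λ p q r s t u →
        p :* (r :+ t) :+ :- (q :* (s :+ u)) :=
        (p :* r :+ :- (q :* s)) :+ (p :* t :+ :- (q :* u))) refl
      (seq p n) (seq q n) (seq r n) (seq s n) (seq t n) (seq u n)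
      where open +-*-Solver

    im-distrib : ∀ p q r s t u →
      p R.* (s R.+ u) R.+ q R.* (r R.+ t) R.≈
      (p R.* s R.+ q R.* r) R.+ (p R.* u R.+ q R.* t)
    im-distrib p q r s t u = pointwise⇒≈ _ _ λ n → solve 6
      (λ p q r s t u →
        p :* (s :+ u) :+ q :* (r :+ t) :=
        (p :* s :+ q :* r) :+ (p :* u :+ q :* t)) refl
      (seq p n) (seq q n) (seq r n) (seq s n) (seq t n) (seq u n)
      where open +-*-Solver

    re-comm : ∀ p q r s → p R.* r R.+ R.- (q R.* s) R.≈ r R.* p R.+ R.- (s R.* q)
    re-comm p q r s = R.+-cong (R.*-comm p r) (R.-‿cong (R.*-comm q s))

    im-comm : ∀ p q r s → p R.* s R.+ q R.* r R.≈ r R.* q R.+ s R.* p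
    im-comm p q r s = R.trans (R.+-comm (p R.* s) (q R.* r))
      (R.+-cong (R.*-comm q r) (R.*-comm p s))

    re-identity : ∀ a b → (R.1# R.* a R.+ R.- (R.0# R.* b)) R.≈ a
    re-identity a b = R.trans
      (R.+-cong (R.*-identityˡ a) (R.trans (R.-‿cong (R.zeroˡ b)) -0≈0))
      (R.+-identityʳ a)
      where
      -0≈0 : R.- R.0# R.≈ R.0#
      -0≈0 = R.trans (R.sym (R.+-identityˡ _)) (R.-‿inverseʳ R.0#)

    im-identity : ∀ a b → (R.1# R.* b R.+ R.0# R.* a) R.≈ b
    im-identity a b = R.trans
      (R.+-cong (R.*-identityˡ b) (R.zeroˡ a)) (R.+-identityʳ b)

    *-cong : ∀ {z z′ w w′} → z ≈ z′ → w ≈ w′ → z * w ≈ z′ * w′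
    *-cong (mk≈ a b) (mk≈ c d) =
      mk≈ (R.+-cong (R.*-cong a c) (R.-‿cong (R.*-cong b d)))
          (R.+-cong (R.*-cong a d) (R.*-cong b c))

    *-comm : ∀ z w → z * w ≈ w * z
    *-comm (a +i b) (c +i d) = mk≈ (re-comm a b c d) (im-comm a b c d)

    *-identityˡ : ∀ z → 1ℂ * z ≈ z
    *-identityˡ (a +i b) = mk≈ (re-identity a b) (im-identity a b)

    *-distribˡ-+ : ∀ z w v → z * (w + v) ≈ z * w + z * v
    *-distribˡ-+ (a +i b) (c +i d) (e +i f) =
      mk≈ (re-distrib a b c d e f) (im-distrib a b c d e f)

    +-cong : ∀ {z z′ w w′} → z ≈ z′ → w ≈ w′ → z + w ≈ z′ + w′
    +-cong (mk≈ a b) (mk≈ c d) = mk≈ (R.+-cong a c) (R.+-cong b d)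

    ≈-trans : Transitive _≈_
    ≈-trans (mk≈ a b) (mk≈ c d) = mk≈ (R.trans a c) (R.trans b d)

  ℂ-commutativeRing : CommutativeRing 0ℓ 0ℓ
  ℂ-commutativeRing = record
    { Carrier = ℂ ; _≈_ = _≈_ ; _+_ = _+_ ; _*_ = _*_ ; -_ = -_
    ; 0# = 0ℂ ; 1# = 1ℂ
    ; isCommutativeRing = record
      { isRing = record
        { +-isAbelianGroup = record
          { isGroup = record
            { isMonoid = record
              { isSemigroup = record
                { isMagma = record
                  { isEquivalence = record
                    { refl = mk≈ R.refl R.refl
                    ; sym = λ (mk≈ a b) → mk≈ (R.sym a) (R.sym b)
                    ; trans = ≈-trans }
                  ; ∙-cong = +-cong }
                ; assoc = λ z w v → mk≈ (R.+-assoc (re z) (re w) (re v))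
                                        (R.+-assoc (im z) (im w) (im v)) }
              ; identity =
                  (λ z → mk≈ (R.+-identityˡ (re z)) (R.+-identityˡ (im z)))
                , (λ z → mk≈ (R.+-identityʳ (re z)) (R.+-identityʳ (im z))) }
            ; inverse =
                (λ z → mk≈ (R.-‿inverseˡ (re z)) (R.-‿inverseˡ (im z)))
              , (λ z → mk≈ (R.-‿inverseʳ (re z)) (R.-‿inverseʳ (im z)))
            ; ⁻¹-cong = λ (mk≈ a b) → mk≈ (R.-‿cong a) (R.-‿cong b) }
          ; comm = λ z w → mk≈ (R.+-comm (re z) (re w)) (R.+-comm (im z) (im w)) }
        ; *-cong = *-cong
        ; *-assoc = λ { (a +i b) (c +i d) (e +i f) →
            mk≈ (re-assoc a b c d e f) (im-assoc a b c d e f) }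
        ; *-identity = *-identityˡ
                     , (λ z → ≈-trans (*-comm z 1ℂ) (*-identityˡ z))
        ; distrib = *-distribˡ-+
                  , (λ z w v → ≈-trans (*-comm (w + v) z)
                      (≈-trans (*-distribˡ-+ z w v)
                        (+-cong (*-comm z w) (*-comm z v)))) }
      ; *-comm = *-comm } }

-- The group algebra R[G]: formal finite sums Σ aᵢ·gᵢ, two of which are
-- equal when every group element has the same total coefficient in both.

module GroupAlgebra
  {r ℓ g ℓ′ : Level} (R : CommutativeRing r ℓ) (G : Group g ℓ′)
  (_≟_ : Decidable (Group._≈_ G)) where

  private
    module R = CommutativeRing R
    module G = Group G

  Element : Set _
  Element = List (R.Carrier × G.Carrier)

  coefficient : Element → G.Carrier → R.Carrier
  coefficient []            g = R.0#
  coefficient ((a , h) ∷ x) g =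
    (if does (h ≟ g) then a else R.0#) R.+ coefficient x g

  infix 4 _≋_
  _≋_ : Element → Element → Set _
  x ≋ y = ∀ g → coefficient x g R.≈ coefficient y g

  ⟦_⟧ : G.Carrier → Element
  ⟦ g ⟧ = (R.1# , g) ∷ []

  𝟙 : Element
  𝟙 = ⟦ G.ε ⟧

  infixr 8 _•_
  _•_ : R.Carrier → Element → Element
  a • x = map (λ (b , g) → a R.* b , g) x

  infixl 6 _⊕_ _⊖_
  _⊕_ _⊖_ : Element → Element → Element
  x ⊕ y = x ++ y
  x ⊖ y = x ⊕ (R.- R.1#) • y

  infixl 7 _⊗_
  _⊗_ : Element → Element → Element
  _⊗_ = cartesianProductWith (λ (a , g) (b , h) → a R.* b , g G.∙ h)

-- Products are composed right to left: (σ ∙ τ)(i) = σ(τ(i)).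
Sym : ℕ → Group 0ℓ 0ℓ
Sym n = record
  { Carrier = Permutation′ n
  ; _≈_ = Perm._≈_
  ; _∙_ = λ σ τ → τ ∘ₚ σ
  ; ε = Perm.id
  ; _⁻¹ = Perm.flip
  ; isGroup = record
    { isMonoid = record
      { isSemigroup = record
        { isMagma = record
          { isEquivalence = record
            { refl = λ _ → refl
            ; sym = λ σ≈τ i → sym (σ≈τ i)
            ; trans = λ σ≈τ τ≈υ i → trans (σ≈τ i) (τ≈υ i) }
          ; ∙-cong = λ {σ} {σ′} {τ} {τ′} σ≈σ′ τ≈τ′ i →
              trans (cong (σ ⟨$⟩ʳ_) (τ≈τ′ i)) (σ≈σ′ (τ′ ⟨$⟩ʳ i)) }
        ; assoc = λ _ _ _ _ → refl }
      ; identity = (λ _ _ → refl) , (λ _ _ → refl) }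
    ; inverse = (λ σ _ → Perm.inverseˡ σ) , (λ σ _ → Perm.inverseʳ σ)
    ; ⁻¹-cong = λ {σ} {τ} σ≈τ i → trans
        (sym (Perm.inverseˡ τ))
        (cong (Perm._⟨$⟩ˡ_ τ)
          (trans (sym (σ≈τ (σ Perm.⟨$⟩ˡ i))) (Perm.inverseʳ σ))) } }

Sym-≟ : ∀ n → Decidable (Group._≈_ (Sym n))
Sym-≟ n σ τ = Fin.all? (λ i → (σ ⟨$⟩ʳ i) Fin.≟ (τ ⟨$⟩ʳ i))

module ℂ[S_] (n : ℕ) = GroupAlgebra Complex.ℂ-commutativeRing (Sym n) (Sym-≟ n)

natℂ : ℕ → Complex.ℂ
natℂ k = k ×ᶜ 1#
  where
  open CommutativeRing Complex.ℂ-commutativeRing using (1#; +-rawMonoid)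
  open import Algebra.Definitions.RawMonoid +-rawMonoid using () renaming (_×_ to _×ᶜ_)

record Graph : Set₁ where
  field
    V      : Set
    _~_    : V → V → Set
    ~-sym  : Symmetric _~_
    ~-irrefl : Irreflexive _≡_ _~_

  -- An edge {u,v} is an adjacent pair, up to the order of its endpoints
  -- (and irrespective of the adjacency proof).
  record Edge : Set where
    constructor edge
    field
      {end₁ end₂} : V
      adjacent    : end₁ ~ end₂
  open Edge public

  SameEdge : Edge → Edge → Set
  SameEdge e f = (end₁ e ≡ end₁ f × end₂ e ≡ end₂ f)
               ⊎ (end₁ e ≡ end₂ f × end₂ e ≡ end₁ f)

  edgeSetoid : Setoid 0ℓ 0ℓ
  edgeSetoid = record
    { Carrier = Edge
    ; _≈_ = SameEdge
    ; isEquivalence = record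
      { refl = inj₁ (refl , refl)
      ; sym = λ { (inj₁ (p , q)) → inj₁ (sym p , sym q)
                ; (inj₂ (p , q)) → inj₂ (sym q , sym p) }
      ; trans = λ
        { (inj₁ (p , q)) (inj₁ (r , s)) → inj₁ (trans p r , trans q s)
        ; (inj₁ (p , q)) (inj₂ (r , s)) → inj₂ (trans p r , trans q s)
        ; (inj₂ (p , q)) (inj₁ (r , s)) → inj₂ (trans p s , trans q r)
        ; (inj₂ (p , q)) (inj₂ (r , s)) → inj₁ (trans p s , trans q r) } } }

  HasOrder : ℕ → Set
  HasOrder n = V ⤖ Fin n

  -- The labels 1, …, n are the elements of Fin n.
  Labeling : ℕ → Set
  Labeling n = V ⤖ Fin n

  record EdgeOrdering : Set where
    open Membership edgeSetoid using (_∈_)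
    open UniqueS edgeSetoid using (Unique)
    field
      edges    : List Edge
      unique   : Unique edges
      complete : ∀ e → e ∈ edges

  Connected : Set
  Connected = V × (∀ u v → Star _~_ u v)

  -- The cycle u, v₁, …, vₖ, u has at least three distinct vertices.
  IsCycle : V → List V → Set
  IsCycle u vs = 2 ℕ.≤ length vs
               × UniqueP.Unique (u ∷ vs)
               × Linked _~_ (u ∷ vs ∷ʳ u)

  Acyclic : Set
  Acyclic = ∀ u vs → ¬ IsCycle u vs

  IsTree : Set
  IsTree = Connected × Acyclic

open Graph public using (HasOrder; Labeling; EdgeOrdering; IsTree)

infix 4 _≅_
_≅_ : Graph → Graph → Set
G ≅ H = Σ[ φ ∈ (G.V ⤖ H.V) ]
          (∀ u v → (u G.~ v) ⇔ (Bijection.to φ u H.~ Bijection.to φ v))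
  where
  module G = Graph G
  module H = Graph H

module _ {n : ℕ} (G : Graph) where

  open Graph G using (Edge; end₁; end₂)
  open ℂ[S_] n

  transposition : Labeling G n → Edge → Permutation′ n
  transposition ℒ e = transpose (Bijection.to ℒ (end₁ e)) (Bijection.to ℒ (end₂ e))

  𝒦 : Labeling G n → EdgeOrdering G → Element
  𝒦 ℒ π = natℂ (n !) •
    foldr _⊗_ 𝟙 (map (λ e → 𝟙 ⊖ ⟦ transposition ℒ e ⟧) (EdgeOrdering.edges π))

-- Expanding 𝒦 gives n! Σ (−1)^|S| ∏S, over the ordered subsets S of the edges.
-- The image of a vertex under ∏S is reached by a trail through distinct edges of
-- S, and in an acyclic graph such a trail never returns to a vertex; so ∏S moves
-- every vertex touched by S.  If ∏S is a transposition (u v), then S touches only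
-- u and v, whence S = {uv}.  The coefficient of a transposition (u v) in 𝒦 is
-- therefore −n! when uv is an edge and 0 otherwise.  Conjugation by σ carries
-- (u v) to (σu σv), so it preserves adjacency.
module Submission where

open import Algebra.Bundles using (Group; CommutativeRing)
import Algebra.Properties.Group as GroupProperties
import Algebra.Properties.Ring as RingProperties
open import Data.Bool.Base using (true; false; if_then_else_)
open import Data.Empty using (⊥; ⊥-elim)
open import Data.Fin.Base using (Fin)
open import Data.Fin.Permutation
  using (Permutation′; transpose; flip; _⟨$⟩ʳ_; _⟨$⟩ˡ_; inverseʳ)
import Data.Fin.Permutation.Components as Components
import Data.Fin.Properties as Fin
open import Data.List.Base using (List; []; _∷_; _++_; _∷ʳ_; foldr; map; [_])
open import Data.List.Membership.Propositional using (_∈_; find)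
open import Data.List.Membership.Propositional.Properties using (∈-∃++; ∈-++⁺ˡ; ∈-insert)
open import Data.List.Properties using (++-identityʳ; ∷-injectiveʳ)
open import Data.List.Relation.Binary.Sublist.Propositional
  using (_⊆_; []; _∷_; from∈; lookup) renaming (_∷ʳ_ to _∷ˢ_)
open import Data.List.Relation.Binary.Sublist.Propositional.Properties using (All-resp-⊆)
open import Data.List.Relation.Unary.All as All using (All; []; _∷_)
open import Data.List.Relation.Unary.AllPairs as AllPairs using (AllPairs; []; _∷_)
open import Data.List.Relation.Unary.Any as Any using (Any; here; there; any?)
open import Data.List.Relation.Unary.Linked using (Linked; [-]; _∷_)
open import Data.List.Relation.Unary.Unique.Propositional using (Unique)
open import Data.List.Relation.Unary.Unique.Propositional.Properties using (Unique[x∷xs]⇒x∉xs)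
open import Data.Nat.Base as ℕ using (ℕ; zero; suc; _!)
import Data.Nat.Properties as ℕ
open import Data.Product.Base using (∃-syntax; ∃₂; _×_; _,_; proj₂)
open import Data.Rational.Base as ℚ using (0ℚ; 1ℚ)
import Data.Rational.Properties as ℚ
open import Data.Sum.Base as Sum using (_⊎_; inj₁; inj₂)
open import Function.Base using (_∘_; id)
open import Function.Bundles using (_⤖_; _⇔_; mk⇔; Bijection; Equivalence)
open import Function.Construct.Composition using (_⤖-∘_)
open import Function.Construct.Symmetry using (⤖-sym)
open import Function.Properties.Inverse using (↔⇒⤖)
open import Level using (Level)
open import Relation.Binary.Bundles using (Setoid)
open import Relation.Binary.Definitions using (Decidable; DecidableEquality)
open import Relation.Binary.PropositionalEquality
  using (_≡_; _≢_; refl; sym; trans; cong; cong₂; subst)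
open import Relation.Nullary using (¬_; does; yes; no)
open import Relation.Nullary.Decidable
  using (dec-true; dec-false; does-⇔; map′; via-injection; _×-dec_; _⊎-dec_; decidable-stable)

open import Defs

-- Pairwise relations and chains under sublists and prefixes

private
  variable
    a p : Level
    A : Set a

AllPairs-resp-⊇ : ∀ {R : A → A → Set p} {xs ys} → xs ⊆ ys → AllPairs R ys → AllPairs R xs
AllPairs-resp-⊇ []         []         = []
AllPairs-resp-⊇ (_ ∷ˢ τ)   (_  ∷ pys) = AllPairs-resp-⊇ τ pys
AllPairs-resp-⊇ (refl ∷ τ) (py ∷ pys) = All-resp-⊆ τ py ∷ AllPairs-resp-⊇ τ pys

AllPairs-++⁻ˡ : ∀ {R : A → A → Set p} xs {ys} → AllPairs R (xs ++ ys) → AllPairs R xs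
AllPairs-++⁻ˡ []       _          = []
AllPairs-++⁻ˡ (x ∷ xs) (px ∷ pxs) =
  All.tabulate (λ z∈xs → All.lookup px (∈-++⁺ˡ z∈xs)) ∷ AllPairs-++⁻ˡ xs pxs

Linked-prefix : ∀ {R : A → A → Set p} xs {y ys} → Linked R (xs ++ y ∷ ys) → Linked R (xs ∷ʳ y)
Linked-prefix []           _         = [-]
Linked-prefix (x ∷ [])     (r ∷ _)   = r ∷ [-]
Linked-prefix (x ∷ z ∷ xs) (r ∷ rs)  = r ∷ Linked-prefix (z ∷ xs) rs

-- Two different positions holding related elements would contradict the pairwise condition;
-- symmetry of `R` covers both orders in which `x` and `y` may occur.
AllPairs¬⇒≡ : ∀ {R : A → A → Set p} → (∀ {x y} → R x y → R y x) →
  ∀ {xs x y} → AllPairs (λ x y → ¬ R x y) xs → x ∈ xs → y ∈ xs → R x y → x ≡ y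
AllPairs¬⇒≡ s (_ ∷ _)  (here refl) (here refl) _ = refl
AllPairs¬⇒≡ s (px ∷ _) (here refl) (there y∈)  r = ⊥-elim (All.lookup px y∈ r)
AllPairs¬⇒≡ s (px ∷ _) (there x∈)  (here refl) r = ⊥-elim (All.lookup px x∈ (s r))
AllPairs¬⇒≡ s (_ ∷ u)  (there x∈)  (there y∈)  r = AllPairs¬⇒≡ s u x∈ y∈ r

-- Transpositions

module _ {n : ℕ} where

  transpose-matchˡ : ∀ (i j : Fin n) → Components.transpose i j i ≡ j
  transpose-matchˡ i j rewrite dec-true (i Fin.≟ i) refl = refl

  transpose-matchʳ : ∀ (i j : Fin n) → Components.transpose i j j ≡ i
  transpose-matchʳ i j with j Fin.≟ i
  ... | yes j≡i = j≡i
  ... | no  _ rewrite dec-true (j Fin.≟ j) refl = refl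

  transpose-other : ∀ {i j k : Fin n} → k ≢ i → k ≢ j → Components.transpose i j k ≡ k
  transpose-other {i} {j} {k} k≢i k≢j
    rewrite dec-false (k Fin.≟ i) k≢i | dec-false (k Fin.≟ j) k≢j = refl

  private
    locate : ∀ (i j k : Fin n) → k ≡ i ⊎ k ≡ j ⊎ (k ≢ i × k ≢ j)
    locate i j k with k Fin.≟ i | k Fin.≟ j
    ... | yes k≡i | _       = inj₁ k≡i
    ... | no _    | yes k≡j = inj₂ (inj₁ k≡j)
    ... | no k≢i  | no k≢j  = inj₂ (inj₂ (k≢i , k≢j))

  transpose-moves : ∀ (i j : Fin n) {k} → Components.transpose i j k ≢ k → k ≡ i ⊎ k ≡ j
  transpose-moves i j {k} moved with locate i j k
  ... | inj₁ k≡i                = inj₁ k≡i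
  ... | inj₂ (inj₁ k≡j)         = inj₂ k≡j
  ... | inj₂ (inj₂ (k≢i , k≢j)) = ⊥-elim (moved (transpose-other k≢i k≢j))

  transpose-comm : ∀ (i j k : Fin n) → Components.transpose i j k ≡ Components.transpose j i k
  transpose-comm i j k with locate i j k
  ... | inj₁ refl               = trans (transpose-matchˡ i j) (sym (transpose-matchʳ j i))
  ... | inj₂ (inj₁ refl)        = trans (transpose-matchʳ i j) (sym (transpose-matchˡ j i))
  ... | inj₂ (inj₂ (k≢i , k≢j)) =
    trans (transpose-other k≢i k≢j) (sym (transpose-other k≢j k≢i))

  -- The rule for conjugating a transposition, freed of inverses: injectivity keeps a point other
  -- than `i` and `j` away from their images.
  transpose-natural : ∀ {f : Fin n → Fin n} → (∀ {i j} → f i ≡ f j → i ≡ j) →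
    ∀ i j k → f (Components.transpose i j k) ≡ Components.transpose (f i) (f j) (f k)
  transpose-natural {f} f-inj i j k with locate i j k
  ... | inj₁ refl               =
    trans (cong f (transpose-matchˡ i j)) (sym (transpose-matchˡ (f i) (f j)))
  ... | inj₂ (inj₁ refl)        =
    trans (cong f (transpose-matchʳ i j)) (sym (transpose-matchʳ (f i) (f j)))
  ... | inj₂ (inj₂ (k≢i , k≢j)) =
    trans (cong f (transpose-other k≢i k≢j)) (sym (transpose-other (k≢i ∘ f-inj) (k≢j ∘ f-inj)))

-- Coefficients in a group algebra

module Coefficients
  {r ℓ g ℓ′ : Level} (R : CommutativeRing r ℓ) (G : Group g ℓ′)
  (_≟_ : Decidable (Group._≈_ G)) where

  open GroupAlgebra R G _≟_
  private
    module R = CommutativeRing R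
    module G = Group G
    module GP = GroupProperties G
  open RingProperties R.ring using (-‿distribˡ-*; -0#≈0#)
  open import Relation.Binary.Reasoning.Setoid R.setoid

  coefficient-cong : ∀ x {k k′} → k G.≈ k′ → coefficient x k ≡ coefficient x k′
  coefficient-cong []            k≈k′ = refl
  coefficient-cong ((a , h) ∷ x) {k} {k′} k≈k′ = cong₂ (λ d c → (if d then a else R.0#) R.+ c)
    (does-⇔ (mk⇔ (λ h≈k → G.trans h≈k k≈k′) (λ h≈k′ → G.trans h≈k′ (G.sym k≈k′)))
      (h ≟ k) (h ≟ k′))
    (coefficient-cong x k≈k′)

  coefficient-⊕ : ∀ x y k → coefficient (x ⊕ y) k R.≈ coefficient x k R.+ coefficient y k
  coefficient-⊕ []            y k = R.sym (R.+-identityˡ _)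
  coefficient-⊕ ((a , h) ∷ x) y k =
    R.trans (R.+-congˡ (coefficient-⊕ x y k)) (R.sym (R.+-assoc _ _ _))

  -- Stated for arbitrary `m` and `f` so that scaling and multiplication by a group element on
  -- either side are instances: the terms landing on `k` are exactly those at `k′`.
  coefficient-map : ∀ (m : R.Carrier → R.Carrier) (f : G.Carrier → G.Carrier) a {k k′} →
    (∀ b → m b R.≈ a R.* b) → (∀ h → f h G.≈ k ⇔ h G.≈ k′) →
    ∀ x → coefficient (map (λ (b , h) → m b , f h) x) k R.≈ a R.* coefficient x k′
  coefficient-map m f a m≈ f≈ [] = R.sym (R.zeroʳ a)
  coefficient-map m f a {k} {k′} m≈ f≈ ((b , h) ∷ x)
    rewrite does-⇔ (f≈ h) (f h ≟ k) (h ≟ k′) =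
    R.trans (R.+-cong (scaled (does (h ≟ k′))) (coefficient-map m f a m≈ f≈ x))
            (R.sym (R.distribˡ a _ _))
    where
    scaled : ∀ d → (if d then m b else R.0#) R.≈ a R.* (if d then b else R.0#)
    scaled true  = m≈ b
    scaled false = R.sym (R.zeroʳ a)

  coefficient-• : ∀ a x k → coefficient (a • x) k R.≈ a R.* coefficient x k
  coefficient-• a x k = coefficient-map (a R.*_) id a (λ _ → R.refl) (λ _ → mk⇔ id id) x

  ⟦⟧-⊗ : ∀ g x → ⟦ g ⟧ ⊗ x ≡ map (λ (b , h) → R.1# R.* b , g G.∙ h) x
  ⟦⟧-⊗ g x = ++-identityʳ _

  ⊗-⟦⟧ : ∀ x g → x ⊗ ⟦ g ⟧ ≡ map (λ (b , h) → b R.* R.1# , h G.∙ g) x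
  ⊗-⟦⟧ []      g = refl
  ⊗-⟦⟧ (_ ∷ x) g = cong (_ ∷_) (⊗-⟦⟧ x g)

  coefficient-conjugate : ∀ g x k →
    coefficient (⟦ g ⟧ ⊗ x ⊗ ⟦ g G.⁻¹ ⟧) (g G.∙ k G.∙ g G.⁻¹) R.≈ coefficient x k
  coefficient-conjugate g x k rewrite ⊗-⟦⟧ (⟦ g ⟧ ⊗ x) (g G.⁻¹) | ⟦⟧-⊗ g x = begin
    coefficient (map (λ (b , h) → b R.* R.1# , h G.∙ g G.⁻¹) gx) (g G.∙ k G.∙ g G.⁻¹)
      ≈⟨ coefficient-map (R._* R.1#) (G._∙ g G.⁻¹) R.1# (λ b → R.*-comm b R.1#)
           (λ h → mk⇔ (GP.∙-cancelʳ _ _ _) G.∙-congʳ) gx ⟩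
    R.1# R.* coefficient gx (g G.∙ k)
      ≈⟨ R.*-identityˡ _ ⟩
    coefficient gx (g G.∙ k)
      ≈⟨ coefficient-map (R.1# R.*_) (g G.∙_) R.1# (λ _ → R.refl)
           (λ h → mk⇔ (GP.∙-cancelˡ _ _ _) G.∙-congˡ) x ⟩
    R.1# R.* coefficient x k
      ≈⟨ R.*-identityˡ _ ⟩
    coefficient x k ∎
    where gx = map (λ (b , h) → R.1# R.* b , g G.∙ h) x

  private
    shift : ∀ {t h k} → t G.∙ h G.≈ k ⇔ h G.≈ t G.⁻¹ G.∙ k
    shift {t} {h} {k} = mk⇔
      (λ th≈k → G.trans (G.sym (GP.\\-leftDividesʳ t h)) (G.∙-congˡ th≈k))
      (λ h≈ → G.trans (G.∙-congˡ h≈) (GP.\\-leftDividesˡ t k))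

  -- The recursion behind the expansion over subsets: either 1 is chosen from this factor, or `t`
  -- is, and then the remaining product must be t⁻¹k.
  coefficient-[1-t]⊗ : ∀ t x k → coefficient ((𝟙 ⊖ ⟦ t ⟧) ⊗ x) k R.≈
    coefficient x k R.- coefficient x (t G.⁻¹ G.∙ k)
  coefficient-[1-t]⊗ t x k rewrite ++-identityʳ
    (map (λ (b , h) → (R.- R.1# R.* R.1#) R.* b , t G.∙ h) x) = begin
    coefficient (map (λ (b , h) → R.1# R.* b , G.ε G.∙ h) x ++
                 map (λ (b , h) → (R.- R.1# R.* R.1#) R.* b , t G.∙ h) x) k
      ≈⟨ coefficient-⊕ (map _ x) _ k ⟩
    _ R.+ _
      ≈⟨ R.+-cong
           (coefficient-map (R.1# R.*_) (G.ε G.∙_) R.1# (λ _ → R.refl)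
             (λ h → mk⇔ (G.trans (G.sym (G.identityˡ h))) (G.trans (G.identityˡ h))) x)
           (coefficient-map ((R.- R.1# R.* R.1#) R.*_) (t G.∙_) (R.- R.1#)
             (λ _ → R.*-congʳ (R.*-identityʳ _)) (λ _ → shift) x) ⟩
    R.1# R.* coefficient x k R.+ R.- R.1# R.* coefficient x (t G.⁻¹ G.∙ k)
      ≈⟨ R.+-cong (R.*-identityˡ _)
           (R.trans (R.sym (-‿distribˡ-* _ _)) (R.-‿cong (R.*-identityˡ _))) ⟩
    coefficient x k R.- coefficient x (t G.⁻¹ G.∙ k) ∎

  module _ {e : Level} {E : Set e} (t : E → G.Carrier) where

    ∏ : List E → G.Carrier
    ∏ = foldr (λ e h → t e G.∙ h) G.ε

    ∏[1-_] : List E → Element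
    ∏[1- es ] = foldr _⊗_ 𝟙 (map (λ e → 𝟙 ⊖ ⟦ t e ⟧) es)

    -- Every term of the expanded product sits at `∏ S` for some sublist `S`. Splitting on whether
    -- `S` takes the head leaves the same claim for the tail, at two group elements.
    coefficient≈0 : ∀ es k → (∀ {S} → S ⊆ es → ¬ (∏ S G.≈ k)) →
      coefficient ∏[1- es ] k R.≈ R.0#
    coefficient≈0 [] k ∏≉k rewrite dec-false (G.ε ≟ k) (∏≉k []) = R.+-identityˡ _
    coefficient≈0 (e ∷ es) k ∏≉k = begin
      coefficient ∏[1- e ∷ es ] k
        ≈⟨ coefficient-[1-t]⊗ (t e) ∏[1- es ] k ⟩
      coefficient ∏[1- es ] k R.- coefficient ∏[1- es ] (t e G.⁻¹ G.∙ k)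
        ≈⟨ R.+-cong (coefficient≈0 es k (λ τ → ∏≉k (e ∷ˢ τ)))
             (R.-‿cong (coefficient≈0 es _ λ τ ∏≈ →
               ∏≉k (refl ∷ τ) (Equivalence.from shift ∏≈))) ⟩
      R.0# R.- R.0#
        ≈⟨ R.-‿inverseʳ R.0# ⟩
      R.0# ∎

    -- This is (-1)^|S|, the coefficient with which the choice of `S` enters the expansion.
    sign : List E → R.Carrier
    sign = foldr (λ _ → R.-_) R.1#

    -- By uniqueness of `S`, one of the two summands of the recursion has no contributing sublist
    -- and vanishes by `coefficient≈0`; induction evaluates the other.
    coefficient≈sign : ∀ {es} → Unique es → ∀ {S k} → S ⊆ es → ∏ S G.≈ k →
      (∀ {S′} → S′ ⊆ es → ∏ S′ G.≈ k → S′ ≡ S) →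
      coefficient ∏[1- es ] k R.≈ sign S
    coefficient≈sign [] {k = k} [] ∏≈k _ rewrite dec-true (G.ε ≟ k) ∏≈k = R.+-identityʳ _
    coefficient≈sign {e ∷ es} (e∉es ∷ u) {S} {k} (_ ∷ˢ τ) ∏≈k only = begin
      coefficient ∏[1- e ∷ es ] k
        ≈⟨ coefficient-[1-t]⊗ (t e) ∏[1- es ] k ⟩
      coefficient ∏[1- es ] k R.- coefficient ∏[1- es ] (t e G.⁻¹ G.∙ k)
        ≈⟨ R.+-cong (coefficient≈sign u τ ∏≈k (λ τ′ → only (e ∷ˢ τ′)))
             -- A contribution here would come from a sublist headed by `e`, which would have to
             -- equal `S` and so put `e` into the tail `es`.
             (R.-‿cong (coefficient≈0 es _ λ τ′ ∏≈ → All.lookup e∉es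
               (lookup τ (subst (e ∈_)
                 (only (refl ∷ τ′) (Equivalence.from shift ∏≈))
                 (here refl)))
               refl)) ⟩
      sign S R.- R.0#
        ≈⟨ R.+-congˡ -0#≈0# ⟩
      sign S R.+ R.0#
        ≈⟨ R.+-identityʳ _ ⟩
      sign S ∎
    coefficient≈sign {e ∷ es} (e∉es ∷ u) {_ ∷ S} {k} (refl ∷ τ) ∏≈k only = begin
      coefficient ∏[1- e ∷ es ] k
        ≈⟨ coefficient-[1-t]⊗ (t e) ∏[1- es ] k ⟩
      coefficient ∏[1- es ] k R.- coefficient ∏[1- es ] (t e G.⁻¹ G.∙ k)
        ≈⟨ R.+-cong
             -- A sublist of the tail with product `k` would have to be `e ∷ S`, again placing `e`
             -- in `es`.
             (coefficient≈0 es k λ τ′ ∏≈ → All.lookup e∉es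
               (lookup τ′ (subst (e ∈_) (sym (only (e ∷ˢ τ′) ∏≈)) (here refl))) refl)
             (R.-‿cong (coefficient≈sign u τ (Equivalence.to shift ∏≈k)
               λ τ′ ∏≈ → ∷-injectiveʳ
                 (only (refl ∷ τ′) (Equivalence.from shift ∏≈)))) ⟩
      R.0# R.- sign S
        ≈⟨ R.+-identityˡ _ ⟩
      R.- sign S ∎

-- Trails in acyclic graphs

module Trails (G : Graph) where

  open Graph G

  Joins : Edge → V → V → Set
  Joins e u v = (end₁ e ≡ u × end₂ e ≡ v) ⊎ (end₁ e ≡ v × end₂ e ≡ u)

  Joins-sym : ∀ e {u v} → Joins e u v → Joins e v u
  Joins-sym e (inj₁ j) = inj₂ j
  Joins-sym e (inj₂ j) = inj₁ j

  Joins⇒~ : ∀ e {u v} → Joins e u v → u ~ v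
  Joins⇒~ e (inj₁ (refl , refl)) = adjacent e
  Joins⇒~ e (inj₂ (refl , refl)) = ~-sym (adjacent e)

  Joins⇒SameEdge : ∀ e f {u v} → Joins e u v → Joins f u v → SameEdge e f
  Joins⇒SameEdge e f (inj₁ (refl , refl)) (inj₁ (p , q)) = inj₁ (sym p , sym q)
  Joins⇒SameEdge e f (inj₁ (refl , refl)) (inj₂ (p , q)) = inj₂ (sym q , sym p)
  Joins⇒SameEdge e f (inj₂ (refl , refl)) (inj₁ (p , q)) = inj₂ (sym q , sym p)
  Joins⇒SameEdge e f (inj₂ (refl , refl)) (inj₂ (p , q)) = inj₁ (sym p , sym q)

  SameEdge⇒Joins : ∀ {u v} (u~v : u ~ v) e → SameEdge (edge u~v) e → Joins e u v
  SameEdge⇒Joins u~v e (inj₁ (p , q)) = inj₁ (sym p , sym q)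
  SameEdge⇒Joins u~v e (inj₂ (p , q)) = inj₂ (sym q , sym p)

  _Touches_ : Edge → V → Set
  e Touches v = end₁ e ≡ v ⊎ end₂ e ≡ v

  Distinct : List Edge → Set
  Distinct = AllPairs (λ e f → ¬ SameEdge e f)

  -- Trail es x p v: from x, one can visit the vertices p in order, ending at v,
  -- along a subsequence of the edges es.
  data Trail : List Edge → V → List V → V → Set where
    stop : ∀ {v} → Trail [] v [] v
    skip : ∀ {e es x p v} → Trail es x p v → Trail (e ∷ es) x p v
    step : ∀ {e es x y p v} → Joins e x y → Trail es y p v → Trail (e ∷ es) x (y ∷ p) v

  last∈ : ∀ {es x p v} → Trail es x p v → v ∈ x ∷ p
  last∈ stop       = here refl
  last∈ (skip t)   = last∈ t
  last∈ (step _ t) = there (last∈ t)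

  Trail⇒Linked : ∀ {es x p v} → Trail es x p v → Linked _~_ (x ∷ p)
  Trail⇒Linked stop             = [-]
  Trail⇒Linked (skip t)         = Trail⇒Linked t
  Trail⇒Linked (step {e} j t)   = Joins⇒~ e j ∷ Trail⇒Linked t

  first-edge : ∀ {es x y p v} → Trail es x (y ∷ p) v → ∃[ e ] e ∈ es × Joins e x y
  first-edge (skip t)   = let e , e∈ , j = first-edge t in e , there e∈ , j
  first-edge (step j _) = _ , here refl , j

  module _ (acyclic : Acyclic) where

    -- Inductively the rest of the trail repeats no vertex, so only a return to the first vertex `x`
    -- is to be excluded: it would reuse an edge or close a cycle.
    trail-unique : ∀ {es x p v} → Distinct es → Trail es x p v → Unique (x ∷ p)
    trail-unique _ stop = [] ∷ []
    trail-unique (_ ∷ d) (skip t) = trail-unique d t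
    trail-unique {x = x} (e∉ ∷ d) (step {e} {y = y} {p} {v} j t) =
      All.tabulate (λ { z∈ refl → x∉ z∈ }) ∷ unique-yp
      where
      unique-yp : Unique (y ∷ p)
      unique-yp = trail-unique d t

      closes : ∀ {ys zs} → p ≡ ys ++ x ∷ zs → ⊥
      -- The trail goes straight back from `y` to `x`: the edge it uses lies later in the list and
      -- yet is the same edge as `e`.
      closes {[]} refl =
        let f , f∈ , j′ = first-edge t
        in All.lookup e∉ f∈ (Joins⇒SameEdge e f j (Joins-sym f j′))
      -- A longer return passes through `y′`, so the part before `x` closes to a genuine cycle; `x`
      -- is not in that part because `y ∷ p` repeats no vertex.
      closes {y′ ∷ ys} {zs} refl = acyclic x (y ∷ y′ ∷ ys)
        ( ℕ.s≤s (ℕ.s≤s ℕ.z≤n)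
        , All.tabulate (λ { z∈ refl → x∉prefix (y ∷ y′ ∷ ys) unique-yp z∈ })
            ∷ AllPairs-++⁻ˡ (y ∷ y′ ∷ ys) unique-yp
        , Joins⇒~ e j ∷ Linked-prefix (y ∷ y′ ∷ ys) (Trail⇒Linked t) )
        where
        x∉prefix : ∀ ws → Unique (ws ++ x ∷ zs) → ¬ (x ∈ ws)
        x∉prefix (w ∷ ws) (w∉ ∷ _) (here refl) = All.lookup w∉ (∈-insert ws) refl
        x∉prefix (w ∷ ws) (_ ∷ u) (there x∈) = x∉prefix ws u x∈

      x∉ : ¬ (x ∈ y ∷ p)
      x∉ (here x≡y)  = ~-irrefl x≡y (Joins⇒~ e j)
      x∉ (there x∈p) = let _ , _ , p≡ = ∈-∃++ x∈p in closes p≡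

-- The coefficients of the transpositions in 𝒦

module _ {n : ℕ} (G : Graph) (ℒ : Labeling G n) where

  open Graph G hiding (Labeling; EdgeOrdering)
  open Trails G
  open Bijection ℒ using () renaming (to to L; injective to L-injective)
  open ℂ[S_] n
  private
    module R = CommutativeRing Complex.ℂ-commutativeRing
    module S = Group (Sym n)
  open Coefficients Complex.ℂ-commutativeRing (Sym n) (Sym-≟ n)

  _≟ⱽ_ : DecidableEquality V
  _≟ⱽ_ = via-injection (Bijection.injection ℒ) Fin._≟_

  -- A search of the complete edge list decides adjacency, which allows adjacency to be concluded by
  -- contradiction from the coefficients.
  adjacent? : EdgeOrdering G → Decidable _~_
  adjacent? π u v = map′
    (λ found → let e , _ , j = find found in Joins⇒~ e j)
    (λ u~v → Any.map (λ {e} → SameEdge⇒Joins u~v e) (EdgeOrdering.complete π (edge u~v)))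
    (any? (λ e → ((end₁ e ≟ⱽ u) ×-dec (end₂ e ≟ⱽ v)) ⊎-dec ((end₁ e ≟ⱽ v) ×-dec (end₂ e ≟ⱽ u)))
      (EdgeOrdering.edges π))

  ∏ₜ : List Edge → Permutation′ n
  ∏ₜ = ∏ (transposition G ℒ)

  -- The rightmost factor acts first, so the trail is read in reverse: it starts at the image `x`
  -- and ends at `v`. The last component later excludes that `x` is `v`, since `v` would then be
  -- both the start and a member of `p`.
  trail-of-product : ∀ es v → ∃₂ λ x p → Trail es x p v × ∏ₜ es ⟨$⟩ʳ L v ≡ L x ×
    (Any (_Touches v) es → v ∈ p)
  trail-of-product [] v = v , [] , stop , refl , λ ()
  trail-of-product (e ∷ es) v with trail-of-product es v
  ... | x , p , t , eq , touched with end₁ e ≟ⱽ x | end₂ e ≟ⱽ x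
  ... | yes refl | _ = end₂ e , x ∷ p , step (inj₂ (refl , refl)) t
    , trans (cong (Components.transpose (L (end₁ e)) (L (end₂ e))) eq)
        (transpose-matchˡ (L (end₁ e)) (L (end₂ e)))
    , λ _ → last∈ t
  ... | no _ | yes refl = end₁ e , x ∷ p , step (inj₁ (refl , refl)) t
    , trans (cong (Components.transpose (L (end₁ e)) (L (end₂ e))) eq)
        (transpose-matchʳ (L (end₁ e)) (L (end₂ e)))
    , λ _ → last∈ t
  ... | no ≢₁ | no ≢₂ = x , p , skip t
    , trans (cong (Components.transpose (L (end₁ e)) (L (end₂ e))) eq)
        (transpose-other (≢₁ ∘ sym ∘ L-injective) (≢₂ ∘ sym ∘ L-injective))
    , λ { (there any)     → touched any
        ; (here touches) → case-last touches (last∈ t) }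
    where
    -- If `e` touches `v` but not `x`, then `v` is not `x`, so lying on the trail puts it in `p`.
    case-last : e Touches v → v ∈ x ∷ p → v ∈ p
    case-last (inj₁ refl) (here v≡x)  = ⊥-elim (≢₁ v≡x)
    case-last (inj₂ refl) (here v≡x)  = ⊥-elim (≢₂ v≡x)
    case-last _           (there v∈p) = v∈p

  module _ (acyclic : Acyclic) where

    -- A fixed point would give a trail that starts at `v` and meets `v` again, against
    -- `trail-unique`.
    product-moves : ∀ {es v} → Distinct es → Any (_Touches v) es → ∏ₜ es ⟨$⟩ʳ L v ≢ L v
    product-moves {es} {v} d touched fixed with trail-of-product es v
    ... | x , p , t , eq , v∈p with refl ← L-injective (trans (sym eq) fixed) =
      Unique[x∷xs]⇒x∉xs (trail-unique acyclic d t) (v∈p touched)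

    -- By `product-moves` both endpoints of a chosen edge are moved, and a transposition moves only
    -- its two points; the endpoints differ since adjacency is irreflexive.
    product-transpose⇒Joins : ∀ {es u v} → Distinct es →
      ∏ₜ es S.≈ transpose (L u) (L v) → ∀ {e} → e ∈ es → Joins e u v
    product-transpose⇒Joins {es} {u} {v} d ∏≈ {e} e∈ =
      joins (moved (inj₁ refl)) (moved (inj₂ refl))
      where
      moved : ∀ {w} → e Touches w → w ≡ u ⊎ w ≡ v
      moved {w} touches = Sum.map L-injective L-injective
        (transpose-moves (L u) (L v) λ fixed →
          product-moves d (Any.map (λ { refl → touches }) e∈)
            (trans (∏≈ (L w)) fixed))
      joins : end₁ e ≡ u ⊎ end₁ e ≡ v → end₂ e ≡ u ⊎ end₂ e ≡ v → Joins e u v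
      joins (inj₁ p) (inj₂ q) = inj₁ (p , q)
      joins (inj₂ p) (inj₁ q) = inj₂ (p , q)
      joins (inj₁ p) (inj₁ q) = ⊥-elim (~-irrefl (trans p (sym q)) (adjacent e))
      joins (inj₂ p) (inj₂ q) = ⊥-elim (~-irrefl (trans p (sym q)) (adjacent e))

    module _ (π : EdgeOrdering G) where

      open EdgeOrdering π

      coefficient-𝒦 : ∀ k → coefficient (𝒦 G ℒ π) k R.≈
        natℂ (n !) R.* coefficient (∏[1-_] (transposition G ℒ) edges) k
      coefficient-𝒦 =
        coefficient-• (natℂ (n !)) (∏[1-_] (transposition G ℒ) edges)

      -- No sublist has this product: the empty one gives the identity, and an edge in a nonempty
      -- one would join `u` and `v`.
      coefficient-nonedge : ∀ {u v} → u ≢ v → ¬ (u ~ v) →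
        coefficient (𝒦 G ℒ π) (transpose (L u) (L v)) R.≈ R.0#
      coefficient-nonedge {u} {v} u≢v u≁v = R.trans (coefficient-𝒦 (transpose (L u) (L v)))
        (R.trans (R.*-congˡ (coefficient≈0 (transposition G ℒ) edges (transpose (L u) (L v)) none))
          (R.zeroʳ (natℂ (n !))))
        where
        none : ∀ {S} → S ⊆ edges → ¬ (∏ₜ S S.≈ transpose (L u) (L v))
        none {[]}    _ ∏≈ = u≢v (L-injective (trans (∏≈ (L u)) (transpose-matchˡ (L u) (L v))))
        none {e ∷ S} τ ∏≈ = u≁v (Joins⇒~ e
          (product-transpose⇒Joins (AllPairs-resp-⊇ τ unique) ∏≈ (here refl)))

      -- The listed edge joining `u` and `v` forms, by itself, the only sublist with this product,
      -- and it enters with sign -1.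
      coefficient-edge : ∀ {u v} → u ~ v →
        coefficient (𝒦 G ℒ π) (transpose (L u) (L v)) R.≈ natℂ (n !) R.* R.- R.1#
      coefficient-edge {u} {v} u~v with find (complete (edge u~v))
      ... | e , e∈ , same = R.trans (coefficient-𝒦 (transpose (L u) (L v)))
        (R.*-congˡ (coefficient≈sign (transposition G ℒ)
          (AllPairs.map (λ { ¬s refl → ¬s (inj₁ (refl , refl)) }) unique)
          {k = transpose (L u) (L v)} (from∈ e∈) ∏e≈ only))
        where
        joins : Joins e u v
        joins = SameEdge⇒Joins u~v e same

        ∏e≈ : ∏ₜ [ e ] S.≈ transpose (L u) (L v)
        ∏e≈ i with joins
        ... | inj₁ (refl , refl) = refl
        ... | inj₂ (refl , refl) = transpose-comm (L v) (L u) i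

        only : ∀ {S} → S ⊆ edges → ∏ₜ S S.≈ transpose (L u) (L v) → S ≡ [ e ]
        only {[]} τ ∏≈ = ⊥-elim (~-irrefl
          (L-injective (trans (∏≈ (L u)) (transpose-matchˡ (L u) (L v)))) u~v)
        -- Every member of the sublist joins `u` and `v`, and members are pairwise different as
        -- edges, so there is no second one.
        only {f ∷ S} τ ∏≈ with AllPairs-resp-⊇ τ unique
        ... | d@(f∉ ∷ _) = cong₂ _∷_ f≡e (empty S f∉ (All.tabulate (J ∘ there)))
          where
          J : ∀ {g} → g ∈ f ∷ S → Joins g u v
          J = product-transpose⇒Joins d ∏≈
          f≡e : f ≡ e
          f≡e = AllPairs¬⇒≡ (λ {x} {y} → Setoid.sym edgeSetoid {x} {y}) unique
            (lookup τ (here refl)) e∈ (Joins⇒SameEdge f e (J (here refl)) joins)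
          empty : ∀ S → All (λ g → ¬ SameEdge f g) S → All (λ g → Joins g u v) S → S ≡ []
          empty []      _        _       = refl
          empty (g ∷ S) (¬s ∷ _) (j ∷ _) = ⊥-elim (¬s (Joins⇒SameEdge f g (J (here refl)) j))

-- Nonvanishing of positive integers in ℂ

natℂ≉0 : ∀ k → k ≢ 0 → ¬ (natℂ k Complex.≈ Complex.0ℂ)
natℂ≉0 zero    k≢0 _ = k≢0 refl
natℂ≉0 (suc k) _   (Complex.mk≈ re≈ _) =
  -- The sequence representing the real part is at least 1 at every index, so convergence to 0
  -- already fails for the tolerance 1.
  let N , close = limit re≈ 1ℚ (ℚ.positive⁻¹ 1ℚ)
  in ℚ.<-irrefl refl (ℚ.<-≤-trans (close N ℕ.≤-refl)
       (subst (1ℚ ℚ.≤_) (sym (distance N)) (1≤ N)))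
  where
  open Reals
  re-seq : ℕ → ℕ → ℚ.ℚ
  re-seq k = seq (Complex.re (natℂ k))
  0≤ : ∀ k N → 0ℚ ℚ.≤ re-seq k N
  0≤ zero    N = ℚ.≤-refl
  0≤ (suc k) N = ℚ.+-mono-≤ (ℚ.<⇒≤ (ℚ.positive⁻¹ 1ℚ)) (0≤ k N)
  1≤ : ∀ N → 1ℚ ℚ.≤ re-seq (suc k) N
  1≤ N = ℚ.+-monoʳ-≤ 1ℚ (0≤ k N)
  distance : ∀ N → ℚ.∣ re-seq (suc k) N ℚ.- 0ℚ ∣ ≡ re-seq (suc k) N
  distance N = trans (cong ℚ.∣_∣ (ℚ.+-identityʳ _)) (ℚ.0≤p⇒∣p∣≡p (0≤ (suc k) N))

-- The isomorphism induced by conjugation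

mainTheorem10 : (n : ℕ) (T₁ T₂ : Graph) →
    IsTree T₁ → IsTree T₂ → HasOrder T₁ n → HasOrder T₂ n →
    (let open ℂ[S_] n) →
    (∃[ ℒ₁ ] ∃[ ℒ₂ ] ∃[ π₁ ] ∃[ π₂ ] ∃[ σ ]
    ⟦ σ ⟧ ⊗ 𝒦 T₁ ℒ₁ π₁ ⊗ ⟦ flip σ ⟧ ≋ 𝒦 T₂ ℒ₂ π₂) →
    T₁ ≅ T₂
mainTheorem10 n T₁ T₂ (_ , acyclic₁) (_ , acyclic₂) _ _ (ℒ₁ , ℒ₂ , π₁ , π₂ , σ , conj) =
  φ , λ u v → mk⇔ (preserves u v) (reflects u v)
  where
  open ℂ[S_] n
  module T₁ = Graph T₁
  module T₂ = Graph T₂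
  module R = CommutativeRing Complex.ℂ-commutativeRing
  open Coefficients Complex.ℂ-commutativeRing (Sym n) (Sym-≟ n)
    using (coefficient-conjugate; coefficient-cong)
  open RingProperties R.ring using (-‿distribʳ-*; -0#≈0#; -‿injective)
  L₁ = Bijection.to ℒ₁
  L₂ = Bijection.to ℒ₂
  σ-injective = Bijection.injective (↔⇒⤖ σ)

  -- The labels of `u` and of its image correspond under `σ`, so conjugation by `σ` acts on the
  -- transpositions as `φ` acts on pairs of vertices.
  φ : T₁.V ⤖ T₂.V
  φ = ⤖-sym ℒ₂ ⤖-∘ (↔⇒⤖ σ ⤖-∘ ℒ₁)

  φ′ = Bijection.to φ

  L₂∘φ : ∀ u → L₂ (φ′ u) ≡ σ ⟨$⟩ʳ L₁ u
  L₂∘φ u = proj₂ (Bijection.strictlySurjective ℒ₂ (σ ⟨$⟩ʳ L₁ u))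

  conjugate-transpose : ∀ u v i →
    σ ⟨$⟩ʳ (transpose (L₁ u) (L₁ v) ⟨$⟩ʳ (σ ⟨$⟩ˡ i)) ≡
    transpose (L₂ (φ′ u)) (L₂ (φ′ v)) ⟨$⟩ʳ i
  conjugate-transpose u v i rewrite L₂∘φ u | L₂∘φ v =
    trans (transpose-natural σ-injective (L₁ u) (L₁ v) (σ ⟨$⟩ˡ i))
      (cong (Components.transpose _ _) (inverseʳ σ))

  same-coefficient : ∀ u v →
    coefficient (𝒦 T₁ ℒ₁ π₁) (transpose (L₁ u) (L₁ v)) R.≈
    coefficient (𝒦 T₂ ℒ₂ π₂) (transpose (L₂ (φ′ u)) (L₂ (φ′ v)))
  same-coefficient u v = R.trans
    (R.sym (coefficient-conjugate σ (𝒦 T₁ ℒ₁ π₁) (transpose (L₁ u) (L₁ v))))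
    -- `conj` is evaluated at the conjugated transposition, which agrees pointwise with the
    -- transposition of the images; `coefficient-cong` bridges the two.
    (R.trans (conj _) (R.reflexive (coefficient-cong (𝒦 T₂ ℒ₂ π₂) (conjugate-transpose u v))))

  -n!≉0 : ¬ (natℂ (n !) R.* R.- R.1# R.≈ R.0#)
  -n!≉0 eq = natℂ≉0 (n !) (ℕ.>⇒≢ (ℕ.1≤n! n)) (-‿injective (begin
    R.- natℂ (n !)             ≈⟨ R.-‿cong (R.*-identityʳ _) ⟨
    R.- (natℂ (n !) R.* R.1#)  ≈⟨ -‿distribʳ-* _ _ ⟩
    natℂ (n !) R.* R.- R.1#    ≈⟨ eq ⟩
    R.0#                       ≈⟨ -0#≈0# ⟨
    R.- R.0#                   ∎))
    where open import Relation.Binary.Reasoning.Setoid R.setoid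

  preserves : ∀ u v → u T₁.~ v → φ′ u T₂.~ φ′ v
  -- Were the images not adjacent, one coefficient would be both -n! and 0; injectivity of `φ` makes
  -- the images distinct, as the non-edge case requires.
  preserves u v u~v = decidable-stable (adjacent? T₂ ℒ₂ π₂ _ _) λ ≁ → -n!≉0
    (R.trans (R.sym (coefficient-edge T₁ ℒ₁ acyclic₁ π₁ u~v))
      (R.trans (same-coefficient u v)
        (coefficient-nonedge T₂ ℒ₂ acyclic₂ π₂
          (λ eq → T₁.~-irrefl (Bijection.injective φ eq) u~v) ≁)))

  reflects : ∀ u v → φ′ u T₂.~ φ′ v → u T₁.~ v
  reflects u v φu~φv = decidable-stable (adjacent? T₁ ℒ₁ π₁ _ _) λ ≁ → -n!≉0
    (R.trans (R.sym (coefficient-edge T₂ ℒ₂ acyclic₂ π₂ φu~φv))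
      (R.trans (R.sym (same-coefficient u v))
        (coefficient-nonedge T₁ ℒ₁ acyclic₁ π₁
          (λ { refl → T₂.~-irrefl refl φu~φv }) ≁)))
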